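{- Let $H<H'$ be consecutive highly composite numbers and let $\gamma$ be an $H'$-admissible exponent-lattice geodesic from $H$ to $H'$. Then every interior vertex $z$ of $\gamma$ (i.e. every vertex other than the two endpoints) satisfies $$z<H\qquad\text{and}\qquad d(z)<d(H).$$ If moreover the transition contains both deletions and insertions, then the first move of $\gamma$ is a deletion and the last move of $\gamma$ is an insertion.
   Context: $d(n)$ denotes the number of positive divisors of $n$. A positive integer $H$ is highly composite if $d(m)<d(H)$ for all integers $1\le m<H$. Two highly composite numbers $H<H'$ are consecutive if no highly composite number lies strictly between them. Write $H=\prod_p p^{a_p}$, $H'=\prod_p p^{b_p}$. An exponent-lattice geodesic from $H$ to $H'$ is a sequence of positive integers starting at $H$ and ending at $H'$ in which each step changes the exponent of exactly one prime by one unit, always in the direction of its target exponent (so it has exactly $\sum_p|b_p-a_p|$ steps). A step increasing an exponent (multiplication by a prime) is an insertion; a step decreasing an exponent (division by a prime) is a deletion. The geodesic is $H'$-admissible if every vertex $z$ satisfies $z\le H'$. -}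

module Defs where

open import Data.Nat using (ℕ; zero; suc; _≤_; _<_; _≟_)
open import Data.Nat.Divisibility using (_∣?_)
open import Data.Nat.Primality using (Prime)
open import Data.Nat.Primality.Factorisation using (factorise; factors)
open import Data.Fin using (Fin; zero; suc; toℕ; fromℕ; inject₁)
open import Data.List using (length; filter; applyUpTo)
open import Data.Product using (_×_; ∃-syntax)
open import Data.Sum using (_⊎_)
open import Relation.Nullary using (¬_)
open import Relation.Binary.PropositionalEquality using (_≡_; _≢_)

d : ℕ → ℕ
d n = length (filter (_∣? n) (applyUpTo suc n))

-- Multiplicity of p in the prime factorisation of n; the value at n = 0 is junk.
exponent : ℕ → ℕ → ℕ
exponent p zero      = 0
exponent p n@(suc _) = length (filter (p ≟_) (factors (factorise n)))

HighlyComposite : ℕ → Set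
HighlyComposite H = 1 ≤ H × (∀ m → 1 ≤ m → m < H → d m < d H)

record Consecutive (H H′ : ℕ) : Set where
  field
    highlyCompositeˡ : HighlyComposite H
    highlyCompositeʳ : HighlyComposite H′
    increasing       : H < H′
    noneBetween      : ∀ m → H < m → m < H′ → ¬ HighlyComposite m

InsertionOf : ℕ → ℕ → ℕ → Set
InsertionOf p x y =
  exponent p y ≡ suc (exponent p x) ×
  (∀ q → Prime q → q ≢ p → exponent q y ≡ exponent q x)

DeletionOf : ℕ → ℕ → ℕ → Set
DeletionOf p x y =
  exponent p x ≡ suc (exponent p y) ×
  (∀ q → Prime q → q ≢ p → exponent q y ≡ exponent q x)

Insertion : ℕ → ℕ → Set
Insertion x y = ∃[ p ] Prime p × InsertionOf p x y

Deletion : ℕ → ℕ → Set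
Deletion x y = ∃[ p ] Prime p × DeletionOf p x y

-- A unit move of one exponent in the direction of its value in the target T.
StepTowards : ℕ → ℕ → ℕ → Set
StepTowards T x y = ∃[ p ] Prime p ×
  ((InsertionOf p x y × exponent p x < exponent p T) ⊎
   (DeletionOf p x y × exponent p T < exponent p x))

record Geodesic (H H′ : ℕ) : Set where
  field
    steps    : ℕ
    vertex   : Fin (suc steps) → ℕ
    positive : ∀ i → 1 ≤ vertex i
    start    : vertex zero ≡ H
    end      : vertex (fromℕ steps) ≡ H′
    step     : ∀ i → StepTowards H′ (vertex (inject₁ i)) (vertex (suc i))

  Interior : Fin (suc steps) → Set
  Interior i = 0 < toℕ i × toℕ i < steps

  -- Move i goes from vertex i to vertex i + 1.
  IsInsertion : Fin steps → Set
  IsInsertion i = Insertion (vertex (inject₁ i)) (vertex (suc i))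

  IsDeletion : Fin steps → Set
  IsDeletion i = Deletion (vertex (inject₁ i)) (vertex (suc i))

  -- Stated existentially, so that they also assert that there is a move.
  FirstMoveIsDeletion : Set
  FirstMoveIsDeletion = ∃[ i ] toℕ i ≡ 0 × IsDeletion i

  LastMoveIsInsertion : Set
  LastMoveIsInsertion = ∃[ i ] suc (toℕ i) ≡ steps × IsInsertion i

  Admissible : Set
  Admissible = ∀ i → vertex i ≤ H′

{-# OPTIONS --safe #-}
-- Let z lie on the geodesic, so that each exponent of z lies between those of H and H′, and put
-- z′ = H H′ / z.  By concavity of c ↦ (c + 1)(a + b − c + 1) on each coordinate,
-- d(H) d(H′) ≤ d(z) d(z′).  If H < z < H′ then also z′ < H′; but every m < H′ has d(m) ≤ d(H),
-- because H and H′ are consecutive, so d(z) d(z′) ≤ d(H)² < d(H) d(H′), a contradiction.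
-- Hence every interior vertex is below H, which forces the first move down and the last move up.
module Submission where

open import Defs
open import Data.Fin using (Fin; zero; suc; toℕ; fromℕ; fromℕ<; inject₁)
open import Data.Fin.Induction using (<-weakInduction)
open import Data.Fin.Properties using (toℕ-injective; toℕ-fromℕ; toℕ-fromℕ<; toℕ-inject₁)
open import Data.List using (List; []; _∷_; _++_; map; length; filter; applyUpTo)
open import Data.List.Membership.Propositional using (_∈_)
open import Data.List.Membership.Propositional.Properties using (∈-applyUpTo⁺; ∈-filter⁺; ∈-filter⁻; ∈-map⁺; ∈-map⁻; ∈-++⁺ˡ; ∈-++⁺ʳ; ∈-++⁻)
open import Data.List.Membership.Propositional.Properties.WithK using (unique∧set⇒bag)
open import Data.List.Properties using (length-++; length-map; filter-accept; filter-reject)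
open import Data.List.Relation.Binary.BagAndSetEquality using (∼bag⇒↭)
open import Data.List.Relation.Binary.Permutation.Propositional.Properties using (↭-length)
open import Data.List.Relation.Unary.All as All using (All; []; _∷_)
open import Data.List.Relation.Unary.Unique.Propositional using (Unique)
import Data.List.Relation.Unary.Unique.Propositional.Properties as Unique
open import Data.Nat using (ℕ; zero; suc; _+_; _*_; _^_; _∸_; _≤_; _<_; pred; z≤n; s≤s; z<s; _≟_; NonZero; >-nonZero; nonTrivial⇒n>1)
open import Data.Nat.Divisibility using (_∣_; _∣?_; divides; ∣-trans; ∣⇒≤; m∣m*n; n∣m*n; ∣1⇒≡1; *-cancelˡ-∣; *-monoʳ-∣)
open import Data.Nat.Induction using (<-rec)
open import Data.Nat.ListAction using (product)
open import Data.Nat.ListAction.Properties using (∈⇒∣product)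
open import Data.Nat.Primality using (Prime; prime?; euclidsLemma; prime⇒nonZero; prime⇒nonTrivial; ¬prime[1])
open import Data.Nat.Primality.Factorisation using (factorise; module PrimeFactorisation)
open import Data.Nat.Properties
open import Data.Nat.Tactic.RingSolver using (solve-∀)
open import Data.Product using (_×_; _,_; proj₁; proj₂; ∃-syntax)
open import Data.Sum using (_⊎_; inj₁; inj₂)
open import Function using (_∘_; mk⇔)
open import Relation.Binary.Definitions using (tri<; tri≈; tri>)
open import Relation.Binary.PropositionalEquality using (_≡_; _≢_; refl; sym; trans; cong; cong₂; subst; subst₂; module ≡-Reasoning)
open import Relation.Nullary using (¬_; yes; no; contradiction)

-- Divisors

divisors : ℕ → List ℕ
divisors n = filter (_∣? n) (applyUpTo suc n)

divisors-unique : ∀ n → Unique (divisors n)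
divisors-unique n = Unique.filter⁺ (_∣? n)
  (Unique.applyUpTo⁺₁ suc n λ i<j _ → <⇒≢ i<j ∘ suc-injective)

∈-divisors⁻ : ∀ {x n} → x ∈ divisors n → x ∣ n
∈-divisors⁻ {n = n} = proj₂ ∘ ∈-filter⁻ (_∣? n) {xs = applyUpTo suc n}

∈-divisors⁺ : ∀ {x n} → 1 ≤ n → x ∣ n → x ∈ divisors n
∈-divisors⁺ {zero} 1≤n (divides q refl) = contradiction (sym (*-zeroʳ q)) (<⇒≢ 1≤n)
∈-divisors⁺ {suc x} {n} 1≤n x∣n =
  ∈-filter⁺ (_∣? n) (∈-applyUpTo⁺ suc (∣⇒≤ {{>-nonZero 1≤n}} x∣n)) x∣n

-- Duplicate-free lists with the same members are permutations of each other. This turns divisor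
-- counting into a comparison of sets.
unique∧set⇒length≡ : ∀ {xs ys : List ℕ} → Unique xs → Unique ys →
  (∀ {x} → x ∈ xs → x ∈ ys) → (∀ {x} → x ∈ ys → x ∈ xs) → length xs ≡ length ys
unique∧set⇒length≡ xs! ys! to from =
  ↭-length (∼bag⇒↭ (unique∧set⇒bag xs! ys! (mk⇔ to from)))

-- If `p * n ≡ q * x`, then by Euclid's lemma `p` divides `q` or `x`, and cancelling `p` leaves `x`
-- or `x / p` as a divisor of `n`.
∣p*n-split : ∀ {p x n} → Prime p → x ∣ p * n → x ∣ n ⊎ (∃[ y ] x ≡ p * y × y ∣ n)
∣p*n-split {p} {x} {n} pp (divides q p*n≡q*x)
  with euclidsLemma q x pp (subst (p ∣_) p*n≡q*x (m∣m*n n))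
... | inj₁ (divides r refl) =
  inj₁ (divides r (*-cancelˡ-≡ n _ p {{prime⇒nonZero pp}} (trans p*n≡q*x (lemma r p x))))
  where
  lemma : ∀ r p x → r * p * x ≡ p * (r * x)
  lemma = solve-∀
... | inj₂ (divides r refl) = inj₂ (r , *-comm r p ,
  divides q (*-cancelˡ-≡ n _ p {{prime⇒nonZero pp}} (trans p*n≡q*x (lemma q r p))))
  where
  lemma : ∀ q r p → q * (r * p) ≡ p * (q * r)
  lemma = solve-∀

∣p^[1+k]*m-split : ∀ {p} k {m x} → Prime p → x ∣ p ^ suc k * m →
  x ∣ p ^ k * m ⊎ (∃[ e ] x ≡ p ^ suc k * e × e ∣ m)
∣p^[1+k]*m-split {p} k {m} {x} pp x∣
  with ∣p*n-split pp (subst (x ∣_) (*-assoc p (p ^ k) m) x∣)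
∣p^[1+k]*m-split k pp x∣ | inj₁ x∣p^k*m = inj₁ x∣p^k*m
∣p^[1+k]*m-split {p} zero {m} pp x∣ | inj₂ (y , refl , y∣m) =
  inj₂ (y , cong (_* y) (sym (*-identityʳ p)) , subst (y ∣_) (*-identityˡ m) y∣m)
∣p^[1+k]*m-split {p} (suc k) {m} pp x∣ | inj₂ (y , refl , y∣)
  with ∣p^[1+k]*m-split k pp y∣
... | inj₁ y∣p^k*m = inj₁ (subst (p * y ∣_) (sym (*-assoc p (p ^ k) m)) (*-monoʳ-∣ p y∣p^k*m))
... | inj₂ (e , refl , e∣m) = inj₂ (e , sym (*-assoc p (p ^ suc k) e) , e∣m)

module _ {p} (pp : Prime p) where

  private instance
    p≢0 : NonZero p
    p≢0 = prime⇒nonZero pp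

  -- Passing from `p ^ k * m` to `p ^ suc k * m` adds exactly the divisors `p ^ suc k * e` with
  -- `e ∣ m`; they are new because `p` does not divide `m`.
  d[p^[1+k]*m] : ∀ k {m} → 1 ≤ m → ¬ p ∣ m → d (p ^ suc k * m) ≡ d (p ^ k * m) + d m
  d[p^[1+k]*m] k {m} 1≤m p∤m = begin
    length (divisors (p ^ suc k * m))
      ≡⟨ unique∧set⇒length≡ (divisors-unique (p ^ suc k * m)) split-unique to from ⟩
    length (divisors (p ^ k * m) ++ map (p ^ suc k *_) (divisors m))
      ≡⟨ length-++ (divisors (p ^ k * m)) ⟩
    d (p ^ k * m) + length (map (p ^ suc k *_) (divisors m))
      ≡⟨ cong (d (p ^ k * m) +_) (length-map _ (divisors m)) ⟩
    d (p ^ k * m) + d m ∎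
    where
    open ≡-Reasoning

    p^_*m>0 : ∀ j → 1 ≤ p ^ j * m
    p^ j *m>0 = *-mono-≤ (m^n>0 p j) 1≤m

    disjoint : ∀ {x} → ¬ (x ∈ divisors (p ^ k * m) × x ∈ map (p ^ suc k *_) (divisors m))
    disjoint (x∈ , x∈map) with ∈-map⁻ (p ^ suc k *_) x∈map
    -- Cancelling `p ^ k` from `p ^ suc k * e ∣ p ^ k * m` leaves `p * e ∣ m`.
    ... | e , _ , refl = p∤m (∣-trans (m∣m*n e) (*-cancelˡ-∣ (p ^ k) {{m^n≢0 p k}}
      (subst (_∣ p ^ k * m) (lemma p (p ^ k) e) (∈-divisors⁻ {n = p ^ k * m} x∈))))
      where
      lemma : ∀ p q e → p * q * e ≡ q * (p * e)
      lemma = solve-∀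

    split-unique : Unique (divisors (p ^ k * m) ++ map (p ^ suc k *_) (divisors m))
    split-unique = Unique.++⁺ (divisors-unique (p ^ k * m))
      (Unique.map⁺ (*-cancelˡ-≡ _ _ (p ^ suc k) {{m^n≢0 p (suc k)}}) (divisors-unique m))
      disjoint

    to : ∀ {x} → x ∈ divisors (p ^ suc k * m) →
      x ∈ divisors (p ^ k * m) ++ map (p ^ suc k *_) (divisors m)
    to x∈ with ∣p^[1+k]*m-split k pp (∈-divisors⁻ {n = p ^ suc k * m} x∈)
    ... | inj₁ x∣           = ∈-++⁺ˡ (∈-divisors⁺ p^ k *m>0 x∣)
    ... | inj₂ (e , refl , e∣m) =
      ∈-++⁺ʳ (divisors (p ^ k * m)) (∈-map⁺ (p ^ suc k *_) (∈-divisors⁺ 1≤m e∣m))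

    from : ∀ {x} → x ∈ divisors (p ^ k * m) ++ map (p ^ suc k *_) (divisors m) →
      x ∈ divisors (p ^ suc k * m)
    from x∈ with ∈-++⁻ (divisors (p ^ k * m)) x∈
    ... | inj₁ x∈ˡ = ∈-divisors⁺ p^ suc k *m>0 (∣-trans (∈-divisors⁻ {n = p ^ k * m} x∈ˡ)
      (subst (p ^ k * m ∣_) (sym (*-assoc p (p ^ k) m)) (n∣m*n p)))
    ... | inj₂ x∈ʳ with ∈-map⁻ (p ^ suc k *_) x∈ʳ
    ... | e , e∈ , refl =
      ∈-divisors⁺ p^ suc k *m>0 (*-monoʳ-∣ (p ^ suc k) (∈-divisors⁻ {n = m} e∈))

  d[p^k*m] : ∀ k {m} → 1 ≤ m → ¬ p ∣ m → d (p ^ k * m) ≡ suc k * d m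
  d[p^k*m] zero    {m} 1≤m p∤m = trans (cong d (*-identityˡ m)) (sym (*-identityˡ (d m)))
  d[p^k*m] (suc k) {m} 1≤m p∤m = begin
    d (p ^ suc k * m)     ≡⟨ d[p^[1+k]*m] k 1≤m p∤m ⟩
    d (p ^ k * m) + d m   ≡⟨ cong (_+ d m) (d[p^k*m] k 1≤m p∤m) ⟩
    suc k * d m + d m     ≡⟨ +-comm (suc k * d m) (d m) ⟩
    suc (suc k) * d m     ∎
    where open ≡-Reasoning

-- Products over primes

-- The range is the primes below `B`. An explicit bound lets several numbers be compared factor by
-- factor over one common range.
∏ₚ : ℕ → (ℕ → ℕ) → ℕ
∏ₚ zero    f = 1
∏ₚ (suc B) f with prime? B
... | yes _ = f B * ∏ₚ B f
... | no  _ = ∏ₚ B f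

∏ₚ-cong : ∀ B {f g} → (∀ p → Prime p → p < B → f p ≡ g p) → ∏ₚ B f ≡ ∏ₚ B g
∏ₚ-cong zero    f≡g = refl
∏ₚ-cong (suc B) f≡g with prime? B
... | yes pB = cong₂ _*_ (f≡g B pB ≤-refl) (∏ₚ-cong B λ p pp → f≡g p pp ∘ m≤n⇒m≤1+n)
... | no  _  = ∏ₚ-cong B λ p pp → f≡g p pp ∘ m≤n⇒m≤1+n

∏ₚ-mono-≤ : ∀ B {f g} → (∀ p → Prime p → f p ≤ g p) → ∏ₚ B f ≤ ∏ₚ B g
∏ₚ-mono-≤ zero    f≤g = ≤-refl
∏ₚ-mono-≤ (suc B) f≤g with prime? B
... | yes pB = *-mono-≤ (f≤g B pB) (∏ₚ-mono-≤ B f≤g)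
... | no  _  = ∏ₚ-mono-≤ B f≤g

∏ₚ-one : ∀ B → ∏ₚ B (λ _ → 1) ≡ 1
∏ₚ-one zero = refl
∏ₚ-one (suc B) with prime? B
... | yes _ = trans (*-identityˡ _) (∏ₚ-one B)
... | no  _ = ∏ₚ-one B

∏ₚ-positive : ∀ B {f} → (∀ p → Prime p → 1 ≤ f p) → 1 ≤ ∏ₚ B f
∏ₚ-positive B {f} 1≤f = subst (_≤ ∏ₚ B f) (∏ₚ-one B) (∏ₚ-mono-≤ B 1≤f)

∏ₚ-* : ∀ B f g → ∏ₚ B f * ∏ₚ B g ≡ ∏ₚ B (λ p → f p * g p)
∏ₚ-* zero f g = refl
∏ₚ-* (suc B) f g with prime? B
... | yes _ = trans (lemma (f B) (∏ₚ B f) (g B) (∏ₚ B g)) (cong (f B * g B *_) (∏ₚ-* B f g))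
  where
  lemma : ∀ a b c e → a * b * (c * e) ≡ a * c * (b * e)
  lemma = solve-∀
... | no  _ = ∏ₚ-* B f g

-- Its product over primes is the single prime `q`, so multiplication by `q` becomes a pointwise
-- product.
only : ℕ → ℕ → ℕ
only q p with q ≟ p
... | yes _ = q
... | no  _ = 1

only-≡ : ∀ q → only q q ≡ q
only-≡ q with q ≟ q
... | yes _   = refl
... | no  q≢q = contradiction refl q≢q

only-≢ : ∀ {q p} → q ≢ p → only q p ≡ 1
only-≢ {q} {p} q≢p with q ≟ p
... | yes q≡p = contradiction q≡p q≢p
... | no  _   = refl

∏ₚ-only : ∀ B {q} → Prime q → q < B → ∏ₚ B (only q) ≡ q
∏ₚ-only (suc B) {q} pq (s≤s q≤B) with prime? B | m≤n⇒m<n∨m≡n q≤B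
... | yes _  | inj₁ q<B  = trans (cong₂ _*_ (only-≢ (<⇒≢ q<B)) (∏ₚ-only B pq q<B)) (*-identityˡ q)
... | no  _  | inj₁ q<B  = ∏ₚ-only B pq q<B
... | no ¬pB | inj₂ refl = contradiction pq ¬pB
... | yes _  | inj₂ refl = trans (cong₂ _*_ (only-≡ q)
  (trans (∏ₚ-cong B λ _ _ p<q → only-≢ (>⇒≢ p<q)) (∏ₚ-one B))) (*-identityʳ q)

-- Integers with prescribed prime exponents

fromExponents : ℕ → (ℕ → ℕ) → ℕ
fromExponents B f = ∏ₚ B λ p → p ^ f p

fromExponents-positive : ∀ B f → 1 ≤ fromExponents B f
fromExponents-positive B f = ∏ₚ-positive B λ p pp → m^n>0 p {{prime⇒nonZero pp}} (f p)

fromExponents-+ : ∀ B f g →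
  fromExponents B f * fromExponents B g ≡ fromExponents B (λ p → f p + g p)
fromExponents-+ B f g = trans (∏ₚ-* B _ _)
  (∏ₚ-cong B λ p _ _ → sym (^-distribˡ-+-* p (f p) (g p)))

fromExponents-suc : ∀ B {q f g} → Prime q → q < B → g q ≡ suc (f q) →
  (∀ p → Prime p → p ≢ q → g p ≡ f p) → fromExponents B g ≡ q * fromExponents B f
fromExponents-suc B {q} {f} {g} pq q<B at-q off-q = begin
  fromExponents B g                       ≡⟨ ∏ₚ-cong B pointwise ⟩
  ∏ₚ B (λ p → only q p * p ^ f p)         ≡⟨ sym (∏ₚ-* B (only q) _) ⟩
  ∏ₚ B (only q) * fromExponents B f       ≡⟨ cong (_* fromExponents B f) (∏ₚ-only B pq q<B) ⟩
  q * fromExponents B f                   ∎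
  where
  open ≡-Reasoning
  pointwise : ∀ p → Prime p → p < B → p ^ g p ≡ only q p * p ^ f p
  pointwise p pp _ with q ≟ p
  ... | yes refl = cong (p ^_) at-q
  ... | no  q≢p  = trans (cong (p ^_) (off-q p pp (q≢p ∘ sym))) (sym (*-identityˡ _))

prime∣^⇒∣ : ∀ {q m} k → Prime q → q ∣ m ^ k → q ∣ m
prime∣^⇒∣ zero    pq q∣1 = contradiction (subst Prime (∣1⇒≡1 q∣1) pq) ¬prime[1]
prime∣^⇒∣ {m = m} (suc k) pq q∣ with euclidsLemma m (m ^ k) pq q∣
... | inj₁ q∣m   = q∣m
... | inj₂ q∣m^k = prime∣^⇒∣ k pq q∣m^k

-- A prime dividing the product divides one of its prime powers, hence is at most a prime below `B`.
∤fromExponents : ∀ B f {q} → Prime q → B ≤ q → ¬ q ∣ fromExponents B f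
∤fromExponents zero    f pq _ q∣1 = contradiction (subst Prime (∣1⇒≡1 q∣1) pq) ¬prime[1]
∤fromExponents (suc B) f pq B<q q∣ with prime? B
... | no  _  = ∤fromExponents B f pq (<⇒≤ B<q) q∣
... | yes pB with euclidsLemma (B ^ f B) _ pq q∣
... | inj₁ q∣B^ = <⇒≱ B<q (∣⇒≤ {{prime⇒nonZero pB}} (prime∣^⇒∣ (f B) pq q∣B^))
... | inj₂ q∣∏  = ∤fromExponents B f pq (<⇒≤ B<q) q∣∏

-- The classical divisor formula, obtained by peeling off the largest prime; the remaining product
-- involves only smaller primes and is not divisible by it.
d-fromExponents : ∀ B f → d (fromExponents B f) ≡ ∏ₚ B (suc ∘ f)
d-fromExponents zero    f = refl
d-fromExponents (suc B) f with prime? B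
... | no  _  = d-fromExponents B f
... | yes pB = trans
  (d[p^k*m] pB (f B) (fromExponents-positive B f) (∤fromExponents B f pB ≤-refl))
  (cong (suc (f B) *_) (d-fromExponents B f))

-- Induction on the list: a new head `q` raises the count of `q` by one and leaves every other count
-- unchanged.
product≡fromExponents : ∀ B {ps} → All Prime ps → All (_< B) ps →
  product ps ≡ fromExponents B (λ p → length (filter (p ≟_) ps))
product≡fromExponents B [] [] = sym (∏ₚ-one B)
product≡fromExponents B {q ∷ ps} (pq ∷ pps) (q<B ∷ ps<B) = begin
  q * product ps
    ≡⟨ cong (q *_) (product≡fromExponents B pps ps<B) ⟩
  q * fromExponents B (λ p → length (filter (p ≟_) ps))
    ≡⟨ sym (fromExponents-suc B pq q<B (cong length (filter-accept (q ≟_) refl))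
         λ p _ p≢q → cong length (filter-reject (p ≟_) p≢q)) ⟩
  fromExponents B (λ p → length (filter (p ≟_) (q ∷ ps))) ∎
  where open ≡-Reasoning

≡fromExponents : ∀ B {n} → 1 ≤ n → n < B → n ≡ fromExponents B (λ p → exponent p n)
≡fromExponents B {n@(suc _)} _ n<B = trans isFactorisation
  -- Every prime factor divides `n`, so it is at most `n` and lies below `B`.
  (product≡fromExponents B factorsPrime (All.tabulate λ p∈ →
    ≤-<-trans (∣⇒≤ (subst (_ ∣_) (sym isFactorisation) (∈⇒∣product p∈))) n<B))
  where open PrimeFactorisation (factorise n) using (isFactorisation; factorsPrime)

-- A move only constrains exponents; rebuilding both numbers from their exponents shows `y ≡ x * p`,
-- and `p` exceeds 1.
InsertionOf⇒< : ∀ {p x y} → Prime p → 1 ≤ x → 1 ≤ y → InsertionOf p x y → x < y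
InsertionOf⇒< {p} {x} {y} pp 1≤x 1≤y (at-p , off-p) = subst (x <_) (sym y≡x*p)
  (m<m*n x p {{>-nonZero 1≤x}} (nonTrivial⇒n>1 p {{prime⇒nonTrivial pp}}))
  where
  -- A bound above `x`, `y` and `p`, so that one range of primes serves both numbers and contains
  -- `p`.
  B = suc (x + y + p)

  y≡x*p : y ≡ x * p
  y≡x*p = begin
    y                                        ≡⟨ ≡fromExponents B 1≤y (s≤s (≤-trans (m≤n+m y x) (m≤m+n (x + y) p))) ⟩
    fromExponents B (λ q → exponent q y)     ≡⟨ fromExponents-suc B pp (s≤s (m≤n+m p (x + y))) at-p off-p ⟩
    p * fromExponents B (λ q → exponent q x) ≡⟨ cong (p *_) (sym (≡fromExponents B 1≤x (s≤s (≤-trans (m≤m+n x y) (m≤m+n (x + y) p))))) ⟩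
    p * x                                    ≡⟨ *-comm p x ⟩
    x * p                                    ∎
    where open ≡-Reasoning

DeletionOf⇒> : ∀ {p x y} → Prime p → 1 ≤ x → 1 ≤ y → DeletionOf p x y → y < x
DeletionOf⇒> pp 1≤x 1≤y (at-p , off-p) =
  InsertionOf⇒< pp 1≤y 1≤x (at-p , λ q pq q≢p → sym (off-p q pq q≢p))

-- Exponents between two given ones

-- Both orientations are allowed, since an exponent may rise or fall on the way from `H` to `H′`.
Between : ℕ → ℕ → ℕ → Set
Between a c b = (a ≤ c × c ≤ b) ⊎ (b ≤ c × c ≤ a)

-- With `c = a + i` and `b = a + i + j` the sum condition forces `e = a + j`, and the two products
-- differ by exactly `i * j`.
ordered-concave : ∀ {a b c e} → c + e ≡ a + b → a ≤ c → c ≤ b → suc a * suc b ≤ suc c * suc e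
ordered-concave {a} {e = e} c+e≡a+b a≤c c≤b
  with m≤n⇒∃[o]m+o≡n a≤c | m≤n⇒∃[o]m+o≡n c≤b
... | i , refl | j , refl with +-cancelˡ-≡ (a + i) e (a + j) (trans c+e≡a+b (lemma a i j))
  where
  lemma : ∀ a i j → a + (a + i + j) ≡ a + i + (a + j)
  lemma = solve-∀
... | refl = subst (suc a * suc (a + i + j) ≤_) (lemma a i j) (m≤m+n _ (i * j))
  where
  lemma : ∀ a i j → suc a * suc (a + i + j) + i * j ≡ suc (a + i) * suc (a + j)
  lemma = solve-∀

between-concave : ∀ {a b c e} → c + e ≡ a + b → Between a c b → suc a * suc b ≤ suc c * suc e
between-concave c+e≡a+b (inj₁ (a≤c , c≤b)) = ordered-concave c+e≡a+b a≤c c≤b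
between-concave {a} {b} {c} {e} c+e≡a+b (inj₂ (b≤c , c≤a)) =
  subst (_≤ suc c * suc e) (*-comm (suc b) (suc a)) (ordered-concave (trans c+e≡a+b (+-comm a b)) b≤c c≤a)

between-≤-sum : ∀ {a b c} → Between a c b → c ≤ a + b
between-≤-sum {a} {b} (inj₁ (_ , c≤b)) = ≤-trans c≤b (m≤n+m b a)
between-≤-sum {a} {b} (inj₂ (_ , c≤a)) = ≤-trans c≤a (m≤m+n a b)

-- The number `w` is `x * y / z`, built from its exponents instead of by division, so that the
-- divisor formula applies to it directly and the bound follows prime by prime.
complement : ∀ {x y z} → 1 ≤ x → 1 ≤ y → 1 ≤ z →
  (∀ p → Prime p → Between (exponent p x) (exponent p z) (exponent p y)) →
  ∃[ w ] 1 ≤ w × z * w ≡ x * y × d x * d y ≤ d z * d w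
complement {x} {y} {z} 1≤x 1≤y 1≤z between =
  w , fromExponents-positive B ew , z*w≡x*y , d-≤
  where
  B = suc (x + y + z)
  ex = λ p → exponent p x
  ey = λ p → exponent p y
  ez = λ p → exponent p z
  -- At primes the truncated subtraction is exact, because an exponent between two others is at most
  -- their sum.
  ew = λ p → ex p + ey p ∸ ez p
  w = fromExponents B ew

  x≡ : x ≡ fromExponents B ex
  x≡ = ≡fromExponents B 1≤x (s≤s (≤-trans (m≤m+n x y) (m≤m+n (x + y) z)))
  y≡ : y ≡ fromExponents B ey
  y≡ = ≡fromExponents B 1≤y (s≤s (≤-trans (m≤n+m y x) (m≤m+n (x + y) z)))
  z≡ : z ≡ fromExponents B ez
  z≡ = ≡fromExponents B 1≤z (s≤s (m≤n+m z (x + y)))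

  ez+ew : ∀ p → Prime p → ez p + ew p ≡ ex p + ey p
  ez+ew p pp = m+[n∸m]≡n (between-≤-sum (between p pp))

  z*w≡x*y : z * w ≡ x * y
  z*w≡x*y = begin
    z * w                                    ≡⟨ cong (_* w) z≡ ⟩
    fromExponents B ez * w                   ≡⟨ fromExponents-+ B ez ew ⟩
    fromExponents B (λ p → ez p + ew p)      ≡⟨ ∏ₚ-cong B (λ p pp _ → cong (p ^_) (ez+ew p pp)) ⟩
    fromExponents B (λ p → ex p + ey p)      ≡⟨ sym (fromExponents-+ B ex ey) ⟩
    fromExponents B ex * fromExponents B ey  ≡⟨ sym (cong₂ _*_ x≡ y≡) ⟩
    x * y                                    ∎
    where open ≡-Reasoning

  d-* : ∀ {m n} f g → m ≡ fromExponents B f → n ≡ fromExponents B g →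
    d m * d n ≡ ∏ₚ B (λ p → suc (f p) * suc (g p))
  d-* f g refl refl =
    trans (cong₂ _*_ (d-fromExponents B f) (d-fromExponents B g)) (∏ₚ-* B _ _)

  d-≤ : d x * d y ≤ d z * d w
  d-≤ = subst₂ _≤_ (sym (d-* ex ey x≡ y≡)) (sym (d-* ez ew z≡ refl))
    (∏ₚ-mono-≤ B λ p pp → between-concave (ez+ew p pp) (between p pp))

-- Consecutive highly composite numbers

d-positive : ∀ {n} → 1 ≤ n → 1 ≤ d n
d-positive {n} 1≤n = subst (1 ≤_)
  (sym (trans (cong d (≡fromExponents (suc n) 1≤n ≤-refl)) (d-fromExponents (suc n) (λ p → exponent p n))))
  (∏ₚ-positive (suc n) λ _ _ → s≤s z≤n)

module _ {H H′} (consecutive : Consecutive H H′) where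

  open Consecutive consecutive

  -- Strong induction: if `H < m` and `d H < d m`, then every `k < m` has `d k ≤ d H < d m`, so `m`
  -- would be highly composite strictly between `H` and `H′`.
  d≤dH : ∀ m → 1 ≤ m → m < H′ → d m ≤ d H
  d≤dH = <-rec _ go
    where
    go : ∀ m → (∀ {k} → k < m → 1 ≤ k → k < H′ → d k ≤ d H) → 1 ≤ m → m < H′ → d m ≤ d H
    go m rec 1≤m m<H′ with <-cmp m H
    ... | tri< m<H _ _  = <⇒≤ (proj₂ highlyCompositeˡ m 1≤m m<H)
    ... | tri≈ _ refl _ = ≤-refl
    ... | tri> _ _ H<m  = ≮⇒≥ λ dH<dm → noneBetween m H<m m<H′
      (1≤m , λ k 1≤k k<m → ≤-<-trans (rec k<m 1≤k (<-trans k<m m<H′)) dH<dm)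

  between⇒≯ : ∀ {z} → z < H′ →
    (∀ p → Prime p → Between (exponent p H) (exponent p z) (exponent p H′)) → ¬ H < z
  between⇒≯ {z} z<H′ between H<z
    with complement (proj₁ highlyCompositeˡ) (proj₁ highlyCompositeʳ) 1≤z between
    where 1≤z = ≤-trans (proj₁ highlyCompositeˡ) (<⇒≤ H<z)
  ... | w , 1≤w , z*w≡H*H′ , dH*dH′≤dz*dw = <-irrefl refl (begin-strict
    d H * d H   <⟨ *-monoʳ-< (d H) {{>-nonZero (d-positive 1≤H)}} dH<dH′ ⟩
    d H * d H′  ≤⟨ dH*dH′≤dz*dw ⟩
    d z * d w   ≤⟨ *-mono-≤ (d≤dH z 1≤z z<H′) (d≤dH w 1≤w w<H′) ⟩
    d H * d H   ∎)
    where
    open ≤-Reasoning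
    1≤H = proj₁ highlyCompositeˡ
    1≤z = ≤-trans 1≤H (<⇒≤ H<z)

    dH<dH′ : d H < d H′
    dH<dH′ = proj₂ highlyCompositeʳ H 1≤H increasing

    w<H′ : w < H′
    -- If `H′ ≤ w`, then `H * H′ ≤ H * w < z * w`, against `z * w ≡ H * H′`.
    w<H′ = ≰⇒> λ H′≤w → <⇒≢
      (≤-<-trans (*-monoʳ-≤ H H′≤w) (*-monoˡ-< w {{>-nonZero 1≤w}} H<z)) (sym z*w≡H*H′)

-- Geodesics

-- The inductive step along a geodesic. The strict inequality in `StepTowards` prevents a unit move
-- from overshooting the target and excludes moves against the orientation of the coordinate.
step-between : ∀ {T x y} → StepTowards T x y → ∀ {p a} → Prime p →
  Between a (exponent p x) (exponent p T) → Between a (exponent p y) (exponent p T)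
step-between {T} {x} {y} (q , _ , move) {p} {a} pp btw with p ≟ q
step-between {T} (q , _ , inj₁ ((_ , off-q) , _)) {p} {a} pp btw | no p≢q =
  subst (λ c → Between a c (exponent p T)) (sym (off-q p pp p≢q)) btw
step-between {T} (q , _ , inj₂ ((_ , off-q) , _)) {p} {a} pp btw | no p≢q =
  subst (λ c → Between a c (exponent p T)) (sym (off-q p pp p≢q)) btw
step-between (q , _ , inj₁ ((at-q , _) , x<T)) pp (inj₁ (a≤x , _)) | yes refl rewrite at-q =
  inj₁ (m≤n⇒m≤1+n a≤x , x<T)
step-between (q , _ , inj₁ (_ , x<T)) pp (inj₂ (T≤x , _)) | yes refl = contradiction T≤x (<⇒≱ x<T)
step-between (q , _ , inj₂ (_ , T<x)) pp (inj₁ (_ , x≤T)) | yes refl = contradiction x≤T (<⇒≱ T<x)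
step-between (q , _ , inj₂ ((at-q , _) , T<x)) pp (inj₂ (_ , x≤a)) | yes refl rewrite at-q =
  inj₂ (≤-pred T<x , <⇒≤ x≤a)

step-source≢target : ∀ {T x y} → StepTowards T x y → x ≢ T
step-source≢target (p , _ , inj₁ (_ , x<T)) refl = <-irrefl refl x<T
step-source≢target (p , _ , inj₂ (_ , T<x)) refl = <-irrefl refl T<x

-- If the move ended at `S`, then before it the exponent of the moved prime would lie one unit on
-- the far side of `S` from `T`, hence outside the range.
step-leaves : ∀ {S T x y} →
  (∀ p → Prime p → Between (exponent p S) (exponent p x) (exponent p T)) →
  StepTowards T x y → y ≢ S
step-leaves between (p , pp , inj₁ ((at-p , _) , x<T)) refl with between p pp
... | inj₁ (S≤x , _) = <⇒≱ (≤-reflexive (sym at-p)) S≤x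
... | inj₂ (T≤x , _) = <⇒≱ x<T T≤x
step-leaves between (p , pp , inj₂ ((at-p , _) , T<x)) refl with between p pp
... | inj₁ (_ , x≤T) = <⇒≱ T<x x≤T
... | inj₂ (_ , x≤S) = <⇒≱ (≤-reflexive (sym at-p)) x≤S

-- With one prime its exponent would have to both rise and fall; with two, the deletion would fix
-- the exponent that the insertion raises.
insertion∧deletion⇒⊥ : ∀ {x y} → Insertion x y → ¬ Deletion x y
insertion∧deletion⇒⊥ (p , pp , at-p , _) (q , _ , at-q , off-q) with p ≟ q
... | yes refl = m≢1+n+m _ {1} (trans at-p (cong suc at-q))
... | no p≢q   = 1+n≢n (trans (sym at-p) (off-q p pp p≢q))

≢⇒1<n : ∀ {n} (i j : Fin n) → i ≢ j → 1 < n
≢⇒1<n {suc zero}    zero zero i≢j = contradiction refl i≢j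
≢⇒1<n {suc (suc n)} _    _    _   = s≤s z<s

module _ {H H′} (consecutive : Consecutive H H′) (γ : Geodesic H H′)
         (admissible : Geodesic.Admissible γ) where

  open Consecutive consecutive
  open Geodesic γ

  vertex-between : ∀ i p → Prime p →
    Between (exponent p H) (exponent p (vertex i)) (exponent p H′)
  vertex-between = <-weakInduction
    (λ i → ∀ p → Prime p → Between (exponent p H) (exponent p (vertex i)) (exponent p H′))
    base
    (λ i ih p pp → step-between {H′} {vertex (inject₁ i)} {vertex (suc i)} (step i) pp (ih p pp))
    where
    base : ∀ p → Prime p → Between (exponent p H) (exponent p (vertex zero)) (exponent p H′)
    base p _ rewrite start with ≤-total (exponent p H) (exponent p H′)
    ... | inj₁ H≤H′ = inj₁ (≤-refl , H≤H′)
    ... | inj₂ H′≤H = inj₂ (H′≤H , ≤-refl)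

  vertex≢end : ∀ i → toℕ i < steps → vertex i ≢ H′
  -- Vertex `i` is the source of move `j`, and no move towards `H′` can start at `H′`.
  vertex≢end i i<n = subst (λ j → vertex j ≢ H′)
    (toℕ-injective (trans (toℕ-inject₁ _) (toℕ-fromℕ< i<n)))
    (step-source≢target {x = vertex (inject₁ j)} {vertex (suc j)} (step j))
    where j = fromℕ< i<n

  vertex≢start : ∀ i → 0 < toℕ i → vertex i ≢ H
  vertex≢start (suc i) _ =
    step-leaves {H} {H′} {vertex (inject₁ i)} (vertex-between (inject₁ i)) (step i)

  interior-below : ∀ i → Interior i → vertex i < H
  interior-below i (0<i , i<n) = ≤∧≢⇒<
    (≮⇒≥ (between⇒≯ consecutive (≤∧≢⇒< (admissible i) (vertex≢end i i<n)) (vertex-between i)))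
    (vertex≢start i 0<i)

  -- An insertion would make the second vertex larger than `H`; with more than one move that vertex
  -- is interior and hence below `H`.
  firstMove : ∀ i → toℕ i ≡ 0 → 1 < steps → IsDeletion i
  firstMove i i≡0 1<n with step i
  ... | p , pp , inj₂ (deletion , _)  = p , pp , deletion
  ... | p , pp , inj₁ (insertion , _) = contradiction
    (interior-below (suc i) (z<s , subst (λ k → suc k < steps) (sym i≡0) 1<n))
    (<-asym (subst (_< vertex (suc i)) source≡H
      (InsertionOf⇒< pp (positive _) (positive _) insertion)))
    where
    source≡H : vertex (inject₁ i) ≡ H
    source≡H = trans (cong vertex (toℕ-injective (trans (toℕ-inject₁ i) i≡0))) start

  -- A deletion ending at `H′` would start above `H′`, but with more than one move its source is
  -- interior and hence below `H < H′`.
  lastMove : ∀ i → suc (toℕ i) ≡ steps → 1 < steps → IsInsertion i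
  lastMove i 1+i≡n 1<n with step i
  ... | p , pp , inj₁ (insertion , _) = p , pp , insertion
  ... | p , pp , inj₂ (deletion , _)  = contradiction
    (<-trans (interior-below (inject₁ i) interior) increasing)
    (<-asym (subst (_< vertex (inject₁ i)) target≡H′
      (DeletionOf⇒> pp (positive _) (positive _) deletion)))
    where
    target≡H′ : vertex (suc i) ≡ H′
    target≡H′ = trans (cong vertex (toℕ-injective (trans 1+i≡n (sym (toℕ-fromℕ steps))))) end

    interior : Interior (inject₁ i)
    interior rewrite toℕ-inject₁ i = ≤-pred (subst (1 <_) (sym 1+i≡n) 1<n) , ≤-reflexive 1+i≡n

corollary4p3 : (H H′ : ℕ) → Consecutive H H′ →
    (γ : Geodesic H H′) → let open Geodesic γ in
    Admissible →
    (∀ i → Interior i → vertex i < H × d (vertex i) < d H) ×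
    ((∃[ i ] IsDeletion i) → (∃[ j ] IsInsertion j) →
    FirstMoveIsDeletion × LastMoveIsInsertion)
corollary4p3 H H′ consecutive γ admissible = interior , ends
  where
  open Geodesic γ
  open Consecutive consecutive

  interior : ∀ i → Interior i → vertex i < H × d (vertex i) < d H
  interior i int = below , proj₂ highlyCompositeˡ (vertex i) (positive i) below
    where below = interior-below consecutive γ admissible i int

  ends : (∃[ i ] IsDeletion i) → (∃[ j ] IsInsertion j) →
    FirstMoveIsDeletion × LastMoveIsInsertion
  ends (i , deletion) (j , insertion) =
    (first , first≡0 , firstMove consecutive γ admissible first first≡0 1<n) ,
    (last , 1+last≡n , lastMove consecutive γ admissible last 1+last≡n 1<n)
    where
    1<n : 1 < steps
    -- No single move is both a deletion and an insertion, so the two given moves are distinct and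
    -- there are at least two.
    1<n = ≢⇒1<n i j λ { refl →
      insertion∧deletion⇒⊥ {vertex (inject₁ i)} {vertex (suc i)} insertion deletion }

    0<n : 0 < steps
    0<n = <⇒≤ 1<n

    first = fromℕ< 0<n

    first≡0 : toℕ first ≡ 0
    first≡0 = toℕ-fromℕ< 0<n

    pred<n : pred steps < steps
    pred<n = ≤-reflexive (suc-pred steps {{>-nonZero 0<n}})

    last = fromℕ< pred<n

    1+last≡n : suc (toℕ last) ≡ steps
    1+last≡n = trans (cong suc (toℕ-fromℕ< pred<n)) (suc-pred steps {{>-nonZero 0<n}})
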